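{- For every integer $k\ge 4$ there exist $q\in\mathbb N$ and $c>0$ such that for all sufficiently large $t$, $$r_k(t;q,5)\ge T_{k-1}(t^c).$$
   Context: $K_n^{(k)}$ is the complete $k$-uniform hypergraph on $n$ vertices. For integers $q\ge p$, $r_k(t;q,p)$ is the smallest integer $n$ such that in every colouring of the edges of $K_n^{(k)}$ with $q$ colours there is a set of $t$ vertices such that the $k$-edges contained in it receive fewer than $p$ distinct colours in total. The tower function is defined by $T_1(x)=x$ and $T_{i+1}(x)=2^{T_i(x)}$. -}

module Defs where

open import Data.Nat as ℕ using (ℕ; zero; suc)
import Data.Nat.Properties as ℕ
open import Data.Integer as ℤ using (ℤ; +_; -[1+_])
import Data.Integer.Properties as ℤ
open import Data.Rational as ℚ using (ℚ; 0ℚ; 1ℚ; _/_; ↥_; ↧ₙ_)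
import Data.Rational.Properties as ℚ
import Data.Rational.Unnormalised as ℚᵘ
import Data.Rational.Unnormalised.Properties as ℚᵘ
open import Data.Fin using (Fin)
open import Data.Fin.Subset using (Subset; ∣_∣; _∈_; _⊆_)
open import Data.Product using (Σ-syntax; ∃-syntax; _×_; _,_; proj₁)
open import Function.Bundles using (_⇔_)
open import Relation.Binary.PropositionalEquality
  using (_≡_; refl; sym; trans; cong; subst; subst₂)
open import Relation.Nullary using (¬_)
import Algebra.Definitions.RawSemiring

------------------------------------------------------------------------
-- Ramsey numbers

-- The edges of the complete k-uniform hypergraph on the vertex set Fin n.
-- The second component is a proposition, so a function out of Edge is a
-- function of the k-subset alone.
Edge : ℕ → ℕ → Set
Edge k n = Σ[ e ∈ Subset n ] ∣ e ∣ ≡ k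

Colouring : ℕ → ℕ → ℕ → Set
Colouring k n q = Edge k n → Fin q

IsSetOfColoursIn : ∀ {k n q} → Colouring k n q → Subset n → Subset q → Set
IsSetOfColoursIn {k} {n} {q} χ S D =
  ∀ (i : Fin q) → i ∈ D ⇔ (Σ[ e ∈ Edge k n ] proj₁ e ⊆ S × χ e ≡ i)

Arrows : (k t q p n : ℕ) → Set
Arrows k t q p n = ∀ (χ : Colouring k n q) →
  Σ[ S ∈ Subset n ] ∣ S ∣ ≡ t ×
    (Σ[ D ∈ Subset q ] IsSetOfColoursIn χ S D × ∣ D ∣ ℕ.< p)

-- r = r_k(t; q, p).  The number is given by its graph, so that its
-- existence (Ramsey's theorem) need not be proved here.
IsRamseyNumber : (k t q p r : ℕ) → Set
IsRamseyNumber k t q p r = Arrows k t q p r × (∀ m → Arrows k t q p m → r ℕ.≤ m)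

------------------------------------------------------------------------
-- Real numbers as lower cuts of ℚ: x corresponds to { p ∈ ℚ | p < x }.

record ℝ : Set₁ where
  field
    _<∙       : ℚ → Set
    inhabited : ∃[ p ] p <∙
    bounded   : ∃[ s ] (∀ {p} → p <∙ → p ℚ.< s)
    downward  : ∀ {p p′} → p′ ℚ.≤ p → p <∙ → p′ <∙
    open′     : ∀ {p} → p <∙ → ∃[ p′ ] p ℚ.< p′ × p′ <∙

infix 4 _<ᶜ_ _≤ℝ_ _<ℝ_

_<ᶜ_ : ℚ → ℝ → Set
p <ᶜ x = ℝ._<∙ x p

_≤ℝ_ : ℝ → ℝ → Set
x ≤ℝ y = ∀ {p} → p <ᶜ x → p <ᶜ y

_<ℝ_ : ℝ → ℝ → Set
x <ℝ y = ∃[ p ] p <ᶜ y × ¬ (p <ᶜ x)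

fromℚ : ℚ → ℝ
fromℚ a = record
  { _<∙       = ℚ._< a
  ; inhabited = a ℚ.- 1ℚ , subst (a ℚ.- 1ℚ ℚ.<_) (ℚ.+-identityʳ a)
                             (ℚ.+-monoʳ-< a (ℚ.negative⁻¹ (ℚ.- 1ℚ)))
  ; bounded   = a , λ p<a → p<a
  ; downward  = ℚ.≤-<-trans
  ; open′     = λ p<a → ℚ.<-dense p<a
  }

0ℝ : ℝ
0ℝ = fromℚ 0ℚ

fromℕ : ℕ → ℝ
fromℕ n = fromℚ (+ n / 1)

------------------------------------------------------------------------
-- Exponentiation of a positive integer base to a real exponent

open Algebra.Definitions.RawSemiring ℚ.+-*-rawSemiring public
  using () renaming (_^_ to _^ℚ_)

infixr 8 _^ℤ_ _^ℝ_

_^ℤ_ : (b : ℕ) .{{_ : ℕ.NonZero b}} → ℤ → ℚ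
b ^ℤ (+ n)    = + (b ℕ.^ n) / 1
b ^ℤ -[1+ n ] = _/_ (+ 1) (b ℕ.^ suc n) {{ℕ.m^n≢0 b (suc n)}}

-- y ≤ b^r for rational r = n/d, expressed as 0 ≤ y and y^d ≤ b^n.
record _≤_^⟨_⟩ (y : ℚ) (b : ℕ) .{{_ : ℕ.NonZero b}} (r : ℚ) : Set where
  constructor mk
  field
    nonneg : 0ℚ ℚ.≤ y
    power  : y ^ℚ (↧ₙ r) ℚ.≤ b ^ℤ (↥ r)

nat : ℕ → ℚ
nat n = + n / 1

/-mono : ∀ m n c d .{{_ : ℕ.NonZero c}} .{{_ : ℕ.NonZero d}} →
         m ℕ.* d ℕ.≤ n ℕ.* c → + m / c ℚ.≤ + n / d
/-mono m n (suc c) (suc d) h = ℚ.toℚᵘ-cancel-≤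
  (ℚᵘ.≤-respˡ-≃ (ℚᵘ.≃-sym (ℚ.toℚᵘ-fromℚᵘ (ℚᵘ.mkℚᵘ (+ m) c)))
  (ℚᵘ.≤-respʳ-≃ (ℚᵘ.≃-sym (ℚ.toℚᵘ-fromℚᵘ (ℚᵘ.mkℚᵘ (+ n) d)))
  (ℚᵘ.*≤* (subst₂ ℤ._≤_ (ℤ.pos-* m (suc d)) (ℤ.pos-* n (suc c)) (ℤ.+≤+ h)))))

nat-mono : ∀ {m n} → m ℕ.≤ n → nat m ℚ.≤ nat n
nat-mono {m} {n} m≤n = /-mono m n 1 1 (ℕ.*-monoˡ-≤ 1 m≤n)

nat-* : ∀ m n → nat m ℚ.* nat n ≡ nat (m ℕ.* n)
nat-* m n = ℚ.toℚᵘ-injective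
  (ℚᵘ.≃-trans (ℚ.toℚᵘ-homo-* (nat m) (nat n))
  (ℚᵘ.≃-trans (ℚᵘ.*-cong (ℚ.toℚᵘ-fromℚᵘ (ℚᵘ.mkℚᵘ (+ m) 0))
                         (ℚ.toℚᵘ-fromℚᵘ (ℚᵘ.mkℚᵘ (+ n) 0)))
  (ℚᵘ.≃-trans (ℚᵘ.*≡* (cong (ℤ._* (+ 1)) (sym (ℤ.pos-* m n))))
  (ℚᵘ.≃-sym (ℚ.toℚᵘ-fromℚᵘ (ℚᵘ.mkℚᵘ (+ (m ℕ.* n)) 0))))))

nat-^ : ∀ m k → nat m ^ℚ k ≡ nat (m ℕ.^ k)
nat-^ m zero    = refl
nat-^ m (suc k) = trans (cong (nat m ℚ.*_) (nat-^ m k)) (nat-* m (m ℕ.^ k))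

^ℚ-pos : ∀ {a} k → 0ℚ ℚ.< a → 0ℚ ℚ.< a ^ℚ k
^ℚ-pos         zero    0<a = ℚ.positive⁻¹ 1ℚ
^ℚ-pos {a} (suc k) 0<a = ℚ.positive⁻¹ (a ℚ.* a ^ℚ k)
  {{ℚ.pos*pos⇒pos a {{ℚ.positive 0<a}} (a ^ℚ k) {{ℚ.positive (^ℚ-pos k 0<a)}}}}

^ℚ-mono-≤ : ∀ {a b} k → 0ℚ ℚ.< a → a ℚ.≤ b → a ^ℚ k ℚ.≤ b ^ℚ k
^ℚ-mono-≤ zero    0<a a≤b = ℚ.≤-refl
^ℚ-mono-≤ {a} {b} (suc k) 0<a a≤b = ℚ.≤-trans
  (ℚ.*-monoˡ-≤-nonNeg a {{ℚ.nonNegative (ℚ.<⇒≤ 0<a)}} (^ℚ-mono-≤ k 0<a a≤b))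
  (ℚ.*-monoʳ-≤-nonNeg (b ^ℚ k)
    {{ℚ.nonNegative (ℚ.<⇒≤ (^ℚ-pos k (ℚ.<-≤-trans 0<a a≤b)))}} a≤b)

^ℚ-mono-< : ∀ {a b} k → 0ℚ ℚ.< a → a ℚ.< b → a ^ℚ suc k ℚ.< b ^ℚ suc k
^ℚ-mono-< {a} {b} k 0<a a<b = ℚ.≤-<-trans
  (ℚ.*-monoˡ-≤-nonNeg a {{ℚ.nonNegative (ℚ.<⇒≤ 0<a)}}
    (^ℚ-mono-≤ k 0<a (ℚ.<⇒≤ a<b)))
  (ℚ.*-monoˡ-<-pos (b ^ℚ k)
    {{ℚ.positive (^ℚ-pos k (ℚ.<-trans 0<a a<b))}} a<b)

module _ (b : ℕ) .{{_ : ℕ.NonZero b}} where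

  0≤^ℤ : ∀ n → 0ℚ ℚ.≤ b ^ℤ n
  0≤^ℤ (+ n)    = nat-mono {0} {b ℕ.^ n} ℕ.z≤n
  0≤^ℤ -[1+ n ] =
    /-mono 0 1 1 (b ℕ.^ suc n) {{_}} {{ℕ.m^n≢0 b (suc n)}} ℕ.z≤n

  ^ℤ-≤ : ∀ n m → n ℤ.≤ + m → b ^ℤ n ℚ.≤ nat (b ℕ.^ m)
  ^ℤ-≤ (+ n)    m (ℤ.+≤+ n≤m) = nat-mono {b ℕ.^ n} {b ℕ.^ m} (ℕ.^-monoʳ-≤ b n≤m)
  ^ℤ-≤ -[1+ n ] m _ =
    /-mono 1 (b ℕ.^ m) (b ℕ.^ suc n) 1 {{ℕ.m^n≢0 b (suc n)}}
      (ℕ.*-mono-≤ (ℕ.m^n>0 b m) (ℕ.m^n>0 b (suc n)))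

≤-nat : ∀ s → s ℚ.≤ nat ℤ.∣ ↥ s ∣
≤-nat s@(ℚ.mkℚ n d _) = ℚ.toℚᵘ-cancel-≤
  (ℚᵘ.≤-respʳ-≃ (ℚᵘ.≃-sym (ℚ.toℚᵘ-fromℚᵘ (ℚᵘ.mkℚᵘ (+ ℤ.∣ n ∣) 0)))
  (ℚᵘ.*≤* (lem n)))
  where
  lem : ∀ n → n ℤ.* + 1 ℤ.≤ + ℤ.∣ n ∣ ℤ.* + suc d
  lem (+ m)    = subst₂ ℤ._≤_ (ℤ.pos-* m 1) (ℤ.pos-* m (suc d))
                   (ℤ.+≤+ (ℕ.*-monoʳ-≤ m (ℕ.s≤s ℕ.z≤n)))
  lem -[1+ m ] = ℤ.-≤+

↥-≤ : ∀ r N → r ℚ.≤ nat N → ↥ r ℤ.≤ + (N ℕ.* ↧ₙ r)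
↥-≤ r@(ℚ.mkℚ n d _) N r≤N =
  subst₂ ℤ._≤_ (ℤ.*-identityʳ n) (sym (ℤ.pos-* N (suc d)))
    (ℚᵘ.drop-*≤* (ℚᵘ.≤-respʳ-≃ (ℚ.toℚᵘ-fromℚᵘ (ℚᵘ.mkℚᵘ (+ N) 0))
      (ℚ.toℚᵘ-mono-≤ r≤N)))

≤^-bounded : ∀ {y b r} .{{_ : ℕ.NonZero b}} N →
             r ℚ.≤ nat N → y ≤ b ^⟨ r ⟩ → y ℚ.≤ nat (b ℕ.^ N)
≤^-bounded {y} {b} {r@(ℚ.mkℚ n d _)} N r≤N (mk _ h) = ℚ.≮⇒≥ λ M<y →
  ℚ.<-irrefl refl (ℚ.<-≤-trans (^ℚ-mono-< d 0<M M<y)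
    (ℚ.≤-trans h (subst (b ^ℤ n ℚ.≤_) eq
      (^ℤ-≤ b n (N ℕ.* suc d) (↥-≤ r N r≤N)))))
  where
  0<M : 0ℚ ℚ.< nat (b ℕ.^ N)
  0<M = ℚ.<-≤-trans (ℚ.positive⁻¹ 1ℚ) (nat-mono {1} {b ℕ.^ N} (ℕ.m^n>0 b N))
  eq : nat (b ℕ.^ (N ℕ.* suc d)) ≡ nat (b ℕ.^ N) ^ℚ suc d
  eq = sym (trans (nat-^ (b ℕ.^ N) (suc d)) (cong nat (ℕ.^-*-assoc b N (suc d))))

-- b^x = sup { b^r | r ∈ ℚ, r < x }, valid because b ≥ 1.
_^ℝ_ : (b : ℕ) .{{_ : ℕ.NonZero b}} → ℝ → ℝ
b ^ℝ x = record
  { _<∙       = λ p → ∃[ r ] r <ᶜ x × (∃[ y ] p ℚ.< y × y ≤ b ^⟨ r ⟩)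
  ; inhabited =
      let r , r<x = ℝ.inhabited x in
      ℚ.- 1ℚ , r , r<x , 0ℚ , ℚ.negative⁻¹ (ℚ.- 1ℚ) ,
      mk ℚ.≤-refl (subst (ℚ._≤ b ^ℤ (↥ r))
                         (sym (ℚ.*-zeroˡ (0ℚ ^ℚ ℚ.denominator-1 r))) (0≤^ℤ b (↥ r)))
  ; bounded   =
      let s , x≤s = ℝ.bounded x ; N = ℤ.∣ ↥ s ∣ in
      nat (b ℕ.^ N) , λ { (r , r<x , y , p<y , y≤bʳ) →
        ℚ.<-≤-trans p<y
          (≤^-bounded N (ℚ.≤-trans (ℚ.<⇒≤ (x≤s r<x)) (≤-nat s)) y≤bʳ) }
  ; downward  = λ { p′≤p (r , r<x , y , p<y , y≤bʳ) →
      r , r<x , y , ℚ.≤-<-trans p′≤p p<y , y≤bʳ }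
  ; open′     = λ { (r , r<x , y , p<y , y≤bʳ) →
      let p′ , p<p′ , p′<y = ℚ.<-dense p<y in
      p′ , p<p′ , r , r<x , y , p′<y , y≤bʳ }
  }

-- T i x for i ≥ 1; the value at i = 0 is junk.
T : ℕ → ℝ → ℝ
T 0             x = x
T 1             x = x
T (suc (suc i)) x = 2 ^ℝ T (suc i) x

{-# OPTIONS --safe #-}
module Submission where

open import Defs
open import Data.Nat using (ℕ; _≤_; _∸_; NonZero)
open import Data.Product using (∃-syntax; _×_)

open import Data.Nat
  using (zero; suc; _+_; _*_; _^_; _<_; z≤n; s≤s; z<s; _<?_; _≟_; >-nonZero; >-nonZero⁻¹)
open import Data.Nat.Properties hiding (suc-injective)
open import Data.Nat.ListAction using (sum)
open import Data.Nat.Tactic.RingSolver using (solve-∀)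
open import Data.Bool using (Bool; true; false)
open import Data.Fin as Fin using (Fin; zero; suc; toℕ; combine)
open import Data.Fin.Properties
  using (combine-injectiveˡ; combine-injectiveʳ; injective⇒≤; suc-injective)
open import Data.Fin.Subset as Subset using (Subset; inside; outside; ∣_∣)
import Data.Integer as ℤ
import Data.Integer.Properties as ℤ
import Data.Rational as ℚ
import Data.Rational.Properties as ℚ
import Data.Rational.Unnormalised as ℚᵘ
import Data.Rational.Unnormalised.Properties as ℚᵘ
open import Data.Vec as Vec using (Vec; []; _∷_; here; there)
open import Data.List
  using (List; []; _∷_; [_]; _++_; length; map; reverse; take; drop; allFin; cartesianProduct)
open import Data.List.Properties
  using (length-++; length-map; length-reverse; length-take; length-drop;
         reverse-involutive; reverse-++; ++-identityʳ; take++drop≡id)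
open import Data.List.Membership.Propositional using (_∈_)
open import Data.List.Membership.Propositional.Properties
  using (∈-map⁺; ∈-++⁺ˡ; ∈-++⁺ʳ; ∈-cartesianProduct⁺; ∈-allFin)
open import Data.List.Relation.Unary.Any using (here; there)
open import Data.List.Relation.Unary.All as All using (All; []; _∷_)
import Data.List.Relation.Unary.All.Properties as All
open import Data.List.Relation.Unary.AllPairs using (AllPairs; []; _∷_)
import Data.List.Relation.Unary.AllPairs.Properties as AllPairs
open import Data.List.Relation.Binary.Sublist.Propositional
  using (_⊆_; []; _∷_; _∷ʳ_; ⊆-refl; ⊆-trans; from∈; minimum)
open import Data.List.Relation.Binary.Sublist.Propositional.Properties
  using (All-resp-⊆; ++⁺; ++⁺ˡ; ++⁺ʳ)
open import Data.Product as Product using (_,_; ∃; ∃₂; proj₁; proj₂)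
open import Data.Sum using (_⊎_; inj₁; inj₂)
open import Function using (_∘_; id; it)
open import Function.Bundles using (Equivalence)
open import Relation.Binary.PropositionalEquality
  using (_≡_; refl; sym; trans; cong; cong₂; subst; subst₂; module ≡-Reasoning)
open import Relation.Nullary using (¬_; does; yes; no; contradiction)
open import Relation.Nullary.Decidable using (dec-true; dec-false)

-- A random 5-colouring of the pairs of 2ᵐ vertices shows all colours between any two
-- sets of size linear in m; ignoring the last vertex gives triples, and then one steps up.
-- A vertex below 2ᴺ is a leaf of the binary tree of depth N, and a (k+1)-edge has the k
-- levels δ₁, …, δₖ at which consecutive vertices branch.  It is coloured by the order type of
-- δ₁, δ₂, δ₃ (one of five: increasing, decreasing, local maximum, and local minimum with
-- δ₁ < δ₃ or δ₁ > δ₃) together with the old colours of (δ₁, …, δₖ) and of (δₖ, …, δ₁).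
-- A set with more than (2s)² leaves either has a path with s left turns or s right turns,
-- and then s levels on which the old colouring shows five colours, or it contains a perfect
-- binary tree of height 3, which realises all five order types.  The size of the sets thus
-- grows only polynomially while the number of vertices is exponentiated.

-- Sets of vertices are sorted lists, and their subsets are sublists.
Sorted : List ℕ → Set
Sorted = AllPairs _<_

-- Colourings are total functions on lists, so that they apply directly to a list of levels or to
-- its reversal. Five colours are witnessed by an injection from `Fin 5`, a form that lifts from
-- sets of levels to sets of vertices edge by edge.
record Rainbow {q} (χ : List ℕ → Fin q) (k : ℕ) (xs : List ℕ) : Set where
  field
    edge        : Fin 5 → List ℕ
    edge-⊆      : ∀ i → edge i ⊆ xs
    length-edge : ∀ i → length (edge i) ≡ k
    distinct    : ∀ {i j} → χ (edge i) ≡ χ (edge j) → i ≡ j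

FiveColoured : (k s N q : ℕ) → (List ℕ → Fin q) → Set
FiveColoured k s N q χ =
  ∀ {xs} → Sorted xs → All (_< N) xs → s ≤ length xs → Rainbow χ k xs

-- The step up

⊆-snoc : ∀ {A : Set} {d : A} xs {es} → es ⊆ xs ++ [ d ] →
         es ⊆ xs ⊎ ∃ λ es′ → es ≡ es′ ++ [ d ] × es′ ⊆ xs
⊆-snoc []       (d ∷ʳ [])     = inj₁ []
⊆-snoc []       (refl ∷ [])   = inj₂ ([] , refl , [])
⊆-snoc (x ∷ xs) (x ∷ʳ es⊆) with ⊆-snoc xs es⊆
... | inj₁ es⊆xs             = inj₁ (x ∷ʳ es⊆xs)
... | inj₂ (es′ , refl , es′⊆) = inj₂ (es′ , refl , x ∷ʳ es′⊆)
⊆-snoc (x ∷ xs) (refl ∷ es⊆) with ⊆-snoc xs es⊆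
... | inj₁ es⊆xs             = inj₁ (refl ∷ es⊆xs)
... | inj₂ (es′ , refl , es′⊆) = inj₂ (x ∷ es′ , refl , refl ∷ es′⊆)

pow-step : ∀ D h → D ^ suc h + suc D ^ h ≤ suc D ^ suc h
pow-step D h = begin
  D * D ^ h + suc D ^ h     ≤⟨ +-monoˡ-≤ _ (*-monoʳ-≤ D (^-monoˡ-≤ h (n≤1+n D))) ⟩
  D * suc D ^ h + suc D ^ h ≡⟨ +-comm (D * suc D ^ h) _ ⟩
  suc D ^ suc h             ∎
  where open ≤-Reasoning

-- This balances the tree recursion: when one subtree of a node is small, the other keeps enough
-- leaves to lower the exponent by one with the base unchanged.
larger-summand : ∀ {h D a b} → suc D ^ suc h < a + b → b ≤ D ^ suc h → suc D ^ h < a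
larger-summand {h} {D} {a} {b} lt b≤ = +-cancelˡ-< (D ^ suc h) _ _ (begin-strict
  D ^ suc h + suc D ^ h ≤⟨ pow-step D h ⟩
  suc D ^ suc h         <⟨ lt ⟩
  a + b                 ≤⟨ +-monoʳ-≤ a b≤ ⟩
  a + D ^ suc h         ≡⟨ +-comm a _ ⟩
  D ^ suc h + a         ∎)
  where open ≤-Reasoning

-- Binary trees of branching levels: one-sided paths and perfect subtrees

module Levels (δ : ℕ → ℕ → ℕ) where

  levels : List ℕ → List ℕ
  levels []           = []
  levels (x ∷ [])     = []
  levels (x ∷ y ∷ zs) = δ x y ∷ levels (y ∷ zs)

  length-levels : ∀ y ys → length (y ∷ ys) ≡ suc (length (levels (y ∷ ys)))
  length-levels y []       = refl
  length-levels y (z ∷ zs) = cong suc (length-levels z zs)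

  levels-snoc : ∀ {d z} y ys → All (λ u → δ u z ≡ d) (y ∷ ys) →
                levels (y ∷ ys ++ [ z ]) ≡ levels (y ∷ ys) ++ [ d ]
  levels-snoc y []       (eq ∷ [])  = cong [_] eq
  levels-snoc y (u ∷ us) (_ ∷ eqs) = cong (δ y u ∷_) (levels-snoc u us eqs)

  Cross : ℕ → List ℕ → List ℕ → Set
  Cross d l r = All (λ x → All (λ y → δ x y ≡ d) r) l

  Cross-⊆ : ∀ {d l r l′ r′} → l′ ⊆ l → r′ ⊆ r → Cross d l r → Cross d l′ r′
  Cross-⊆ l′⊆ r′⊆ = All.map (All-resp-⊆ r′⊆) ∘ All-resp-⊆ l′⊆

  -- The list holds the leaves from left to right. The bound `b` is strict, which makes the levels
  -- decrease strictly from the root downwards.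
  data Tree (b : ℕ) : List ℕ → Set where
    leaf : ∀ x → Tree b [ x ]
    node : ∀ {d l r} → d < b → Tree d l → Tree d r → Cross d l r → Tree b (l ++ r)

  data Perfect : ℕ → ℕ → List ℕ → Set where
    leaf : ∀ {b} x → Perfect 0 b [ x ]
    node : ∀ {h b d l r} → d < b → Perfect h d l → Perfect h d r → Cross d l r →
           Perfect (suc h) b (l ++ r)

  Tree-mono : ∀ {b b′ xs} → b ≤ b′ → Tree b xs → Tree b′ xs
  Tree-mono b≤b′ (leaf x)             = leaf x
  Tree-mono b≤b′ (node d<b tl tr cr) = node (<-≤-trans d<b b≤b′) tl tr cr

  Perfect-mono : ∀ {h b b′ xs} → b ≤ b′ → Perfect h b xs → Perfect h b′ xs
  Perfect-mono b≤b′ (leaf x)             = leaf x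
  Perfect-mono b≤b′ (node d<b tl tr cr) = node (<-≤-trans d<b b≤b′) tl tr cr

  someLeaf : ∀ {b xs} → Tree b xs → ∃ λ x → [ x ] ⊆ xs
  someLeaf (leaf x) = x , ⊆-refl
  someLeaf (node {r = r} _ tl _ _) with x , x⊆ ← someLeaf tl = x , ++⁺ʳ r x⊆

  -- The levels of n branching nodes on one path of the tree, at all of which the path
  -- turns left (ρ = id) or right (ρ = reverse), listed from the deepest to the topmost.
  record Chain (ρ : List ℕ → List ℕ) (n b : ℕ) (xs : List ℕ) : Set where
    field
      ds        : List ℕ
      length-ds : length ds ≡ n
      sorted    : Sorted ds
      below     : All (_< b) ds
      realise   : ∀ {es} → es ⊆ ds → ∃₂ λ y ys → y ∷ ys ⊆ xs × levels (y ∷ ys) ≡ ρ es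
  open Chain

  Chain-mono : ∀ {ρ n b b′ xs xs′} → b ≤ b′ → xs ⊆ xs′ → Chain ρ n b xs → Chain ρ n b′ xs′
  Chain-mono b≤b′ xs⊆ c = record
    { ds        = ds c
    ; length-ds = length-ds c
    ; sorted    = sorted c
    ; below     = All.map (λ d<b → <-≤-trans d<b b≤b′) (below c)
    ; realise   = λ es⊆ → let y , ys , ys⊆ , eq = realise c es⊆ in
                          y , ys , ⊆-trans ys⊆ xs⊆ , eq
    }

  emptyChain : ∀ {ρ b xs} → ρ [] ≡ [] → Tree b xs → Chain ρ 0 b xs
  emptyChain ρ[]≡[] t = record
    { ds = [] ; length-ds = refl ; sorted = [] ; below = []
    ; realise = λ { [] → let x , x⊆ = someLeaf t in x , [] , x⊆ , sym ρ[]≡[] }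
    }

  module _ {ρ n b d xs xs′} (d<b : d < b) (xs⊆ : xs ⊆ xs′) (c : Chain ρ n d xs)
    (extend : ∀ {es y ys} → y ∷ ys ⊆ xs → levels (y ∷ ys) ≡ ρ es →
              ∃₂ λ z zs → z ∷ zs ⊆ xs′ × levels (z ∷ zs) ≡ ρ (es ++ [ d ])) where

    extendChain : Chain ρ (suc n) b xs′
    extendChain = record
      { ds        = ds c ++ [ d ]
      ; length-ds = trans (length-++ (ds c)) (trans (+-comm _ 1) (cong suc (length-ds c)))
      ; sorted    = AllPairs.++⁺ (sorted c) ([] ∷ []) (All.map (_∷ []) (below c))
      ; below     = All.++⁺ (All.map (λ e<d → <-trans e<d d<b) (below c)) (d<b ∷ [])
      ; realise   = realise′
      }
      where
      realise′ : ∀ {es} → es ⊆ ds c ++ [ d ] →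
                 ∃₂ λ z zs → z ∷ zs ⊆ xs′ × levels (z ∷ zs) ≡ ρ es
      realise′ es⊆ with ⊆-snoc (ds c) es⊆
      ... | inj₁ es⊆ds = let y , ys , ys⊆ , eq = realise c es⊆ds in
                         y , ys , ⊆-trans ys⊆ xs⊆ , eq
      ... | inj₂ (es′ , refl , es′⊆) = let y , ys , ys⊆ , eq = realise c es′⊆ in
                                       extend ys⊆ eq

  -- The path goes on into `l`, so a leaf of `r` can be put after the vertices chosen there; it
  -- branches off from all of them at `d`. The new top level comes last, and the levels are read off
  -- in increasing order.
  turnLeft : ∀ {n b d l r} → d < b → Cross d l r → Tree d r →
             Chain id n d l → Chain id (suc n) b (l ++ r)
  turnLeft {d = d} {l} {r} d<b cr tr c =
    extendChain d<b (++⁺ʳ r ⊆-refl) c λ {es} {y} {ys} ys⊆ eq →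
      let z , z⊆ = someLeaf tr in
      y , ys ++ [ z ] , ++⁺ ys⊆ z⊆ ,
      trans (levels-snoc y ys (All.map All.head (Cross-⊆ ys⊆ z⊆ cr))) (cong (_++ [ d ]) eq)

  -- Mirror image: a leaf of `l` goes before the chosen vertices, so the new top level comes first
  -- and the levels are read off in decreasing order.
  turnRight : ∀ {n b d l r} → d < b → Cross d l r → Tree d l →
              Chain reverse n d r → Chain reverse (suc n) b (l ++ r)
  turnRight {d = d} {l} {r} d<b cr tl c =
    extendChain d<b (++⁺ˡ l ⊆-refl) c λ {es} {y} {ys} ys⊆ eq →
      let z , z⊆ = someLeaf tl in
      z , y ∷ ys , ++⁺ z⊆ ys⊆ ,
      trans (cong₂ _∷_ (All.head (All.head (Cross-⊆ z⊆ ys⊆ cr))) eq)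
            (sym (reverse-++ es [ d ]))

  ChainOrPerfect : (h m n b : ℕ) → List ℕ → Set
  ChainOrPerfect h m n b xs =
    Chain id m b xs ⊎ Chain reverse n b xs ⊎ ∃ λ ys → ys ⊆ xs × Perfect h b ys

  -- Write m + n = D + 1. If a subtree has more than D ^ h leaves, one turn fewer in its direction
  -- is asked for there, and the root supplies the missing turn. Otherwise both subtrees are small,
  -- so by `larger-summand` each has more than (D + 1) ^ (h - 1) leaves; unless a chain appears,
  -- each contains a perfect tree of height h, and the root joins the two.
  chain-or-perfect : ∀ h m n {b xs} → Tree b xs → (m + n) ^ h < length xs →
                     ChainOrPerfect (suc h) m n b xs
  chain-or-perfect h zero    n       t        _ = inj₁ (emptyChain refl t)
  chain-or-perfect h (suc m) zero    t        _ = inj₂ (inj₁ (emptyChain refl t))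
  chain-or-perfect h (suc m) (suc n) (leaf x) lt =
    contradiction (≤-<-trans (m^n>0 (suc m + suc n) h) lt) (<-irrefl refl)
  chain-or-perfect zero (suc m) (suc n) (node d<b tl tr cr) lt =
    let x , x⊆ = someLeaf tl ; y , y⊆ = someLeaf tr in
    inj₂ (inj₂ (_ , ++⁺ x⊆ y⊆ , node d<b (leaf x) (leaf y) (Cross-⊆ x⊆ y⊆ cr)))
  chain-or-perfect (suc h) (suc m) (suc n) {b} (node {d} {l} {r} d<b tl tr cr) lt
    with (m + suc n) ^ suc h <? length l | (m + suc n) ^ suc h <? length r
  ... | yes l-large | _ with chain-or-perfect (suc h) m (suc n) tl l-large
  ...   | inj₁ c                    = inj₁ (turnLeft d<b cr tr c)
  ...   | inj₂ (inj₁ c)             = inj₂ (inj₁ (Chain-mono (<⇒≤ d<b) (++⁺ʳ r ⊆-refl) c))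
  ...   | inj₂ (inj₂ (_ , ys⊆ , p)) = inj₂ (inj₂ (_ , ++⁺ʳ r ys⊆ , Perfect-mono (<⇒≤ d<b) p))
  chain-or-perfect (suc h) (suc m) (suc n) {b} (node {d} {l} {r} d<b tl tr cr) lt
      | no _ | yes r-large
    with chain-or-perfect (suc h) (suc m) n tr
           (subst (λ D → D ^ suc h < length r) (+-suc m n) r-large)
  ...   | inj₁ c                    = inj₁ (Chain-mono (<⇒≤ d<b) (++⁺ˡ l ⊆-refl) c)
  ...   | inj₂ (inj₁ c)             = inj₂ (inj₁ (turnRight d<b cr tl c))
  ...   | inj₂ (inj₂ (_ , ys⊆ , p)) = inj₂ (inj₂ (_ , ++⁺ˡ l ys⊆ , Perfect-mono (<⇒≤ d<b) p))
  chain-or-perfect (suc h) (suc m) (suc n) {b} (node {d} {l} {r} d<b tl tr cr) lt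
      | no l-small | no r-small
    with lt′ ← subst ((suc m + suc n) ^ suc h <_) (length-++ l) lt
    with chain-or-perfect h (suc m) (suc n) tl
           (larger-summand {h} lt′ (≮⇒≥ r-small))
       | chain-or-perfect h (suc m) (suc n) tr
           (larger-summand {h} (subst ((suc m + suc n) ^ suc h <_) (+-comm (length l) _) lt′)
             (≮⇒≥ l-small))
  ...   | inj₁ c        | _             = inj₁ (Chain-mono (<⇒≤ d<b) (++⁺ʳ r ⊆-refl) c)
  ...   | inj₂ (inj₁ c) | _             = inj₂ (inj₁ (Chain-mono (<⇒≤ d<b) (++⁺ʳ r ⊆-refl) c))
  ...   | inj₂ (inj₂ _) | inj₁ c        = inj₁ (Chain-mono (<⇒≤ d<b) (++⁺ˡ l ⊆-refl) c)
  ...   | inj₂ (inj₂ _) | inj₂ (inj₁ c) = inj₂ (inj₁ (Chain-mono (<⇒≤ d<b) (++⁺ˡ l ⊆-refl) c))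
  ...   | inj₂ (inj₂ (_ , ys⊆ , p)) | inj₂ (inj₂ (_ , zs⊆ , p′)) =
    inj₂ (inj₂ (_ , ++⁺ ys⊆ zs⊆ , node d<b p p′ (Cross-⊆ ys⊆ zs⊆ cr)))

-- The comparisons are δ₁ < δ₂, δ₂ < δ₃ and δ₁ < δ₃.
shape : Bool → Bool → Bool → Fin 5
shape true  true  _     = zero
shape false false _     = suc zero
shape true  false _     = suc (suc zero)
shape false true  true  = suc (suc (suc zero))
shape false true  false = suc (suc (suc (suc zero)))

-- The default value is for lists of fewer than three levels; an edge with at least four vertices
-- has at least three.
shapeOf : List ℕ → Fin 5
shapeOf (a ∷ b ∷ c ∷ _) = shape (does (a <? b)) (does (b <? c)) (does (a <? c))
shapeOf _               = zero

module Shapes (δ : ℕ → ℕ → ℕ) where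
  open Levels δ

  shaped : ∀ {w x y z a b c p q r ys} i → w ∷ x ∷ y ∷ z ∷ [] ⊆ ys →
           δ w x ≡ a → δ x y ≡ b → δ y z ≡ c →
           does (a <? b) ≡ p → does (b <? c) ≡ q → does (a <? c) ≡ r → shape p q r ≡ i →
           ∃ λ es → es ⊆ ys × length es ≡ 4 × (∀ ws → shapeOf (levels (es ++ ws)) ≡ i)
  shaped i es⊆ refl refl refl refl refl refl eq = _ , es⊆ , refl , λ ws → eq

  lt : ∀ {a b} → a < b → does (a <? b) ≡ true
  lt {a} {b} = dec-true (a <? b)

  gt : ∀ {a b} → b < a → does (a <? b) ≡ false
  gt {a} {b} b<a = dec-false (a <? b) (<⇒≯ b<a)

  -- With `d` the level of the root, `d₁`, `d₂` those of its children and `d₁₁` to `d₂₂` those of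
  -- its grandchildren, the level sequences used are (d₁₁, d₁, d), (d, d₂, d₂₂), (d₁, d, d₂), (d₁,
  -- d₁₂, d) and (d, d₂₁, d₂). Appending `ws` does not affect the first three levels, so the same
  -- quadruples serve in larger edges.
  perfect⇒allShapes : ∀ {b ys} → Perfect 3 b ys → ∀ i →
    ∃ λ es → es ⊆ ys × length es ≡ 4 × (∀ ws → shapeOf (levels (es ++ ws)) ≡ i)
  perfect⇒allShapes
    (node {d = d} _
      (node {d = d₁} d₁<d
        (node d₁₁<d₁ (leaf x₁) (leaf x₂) ((x₁x₂ ∷ []) ∷ []))
        (node d₁₂<d₁ (leaf x₃) (leaf x₄) ((x₃x₄ ∷ []) ∷ []))
        ((x₁x₃ ∷ x₁x₄ ∷ []) ∷ (x₂x₃ ∷ x₂x₄ ∷ []) ∷ []))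
      (node {d = d₂} d₂<d
        (node d₂₁<d₂ (leaf x₅) (leaf x₆) ((x₅x₆ ∷ []) ∷ []))
        (node d₂₂<d₂ (leaf x₇) (leaf x₈) ((x₇x₈ ∷ []) ∷ []))
        ((x₅x₇ ∷ x₅x₈ ∷ []) ∷ (x₆x₇ ∷ x₆x₈ ∷ []) ∷ []))
      ((x₁x₅ ∷ _) ∷ _ ∷ (x₃x₅ ∷ _) ∷ (x₄x₅ ∷ _) ∷ [])) = λ where
    zero →
      shaped zero (refl ∷ refl ∷ refl ∷ x₄ ∷ʳ refl ∷ minimum _) x₁x₂ x₂x₃ x₃x₅
        (lt d₁₁<d₁) (lt d₁<d) refl refl
    (suc zero) →
      shaped (suc zero) (refl ∷ x₂ ∷ʳ x₃ ∷ʳ x₄ ∷ʳ refl ∷ x₆ ∷ʳ refl ∷ refl ∷ []) x₁x₅ x₅x₇ x₇x₈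
        (gt d₂<d) (gt d₂₂<d₂) refl refl
    (suc (suc zero)) →
      shaped (suc (suc zero)) (refl ∷ x₂ ∷ʳ refl ∷ x₄ ∷ʳ refl ∷ x₆ ∷ʳ refl ∷ minimum _)
        x₁x₃ x₃x₅ x₅x₇ (lt d₁<d) (gt d₂<d) refl refl
    (suc (suc (suc zero))) →
      shaped (suc (suc (suc zero))) (refl ∷ x₂ ∷ʳ refl ∷ refl ∷ refl ∷ minimum _)
        x₁x₃ x₃x₄ x₄x₅ (gt d₁₂<d₁) (lt (<-trans d₁₂<d₁ d₁<d)) (lt d₁<d) refl
    (suc (suc (suc (suc zero)))) →
      shaped (suc (suc (suc (suc zero)))) (refl ∷ x₂ ∷ʳ x₃ ∷ʳ x₄ ∷ʳ refl ∷ refl ∷ refl ∷ minimum _)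
        x₁x₅ x₅x₆ x₆x₇ (gt (<-trans d₂₁<d₂ d₂<d)) (lt d₂₁<d₂) (gt d₂<d) refl

-- For x ≠ y in [o, o + 2ⁿ): the highest binary digit in which x - o and y - o differ.
δ : (n o x y : ℕ) → ℕ
δ zero    o x y = 0
δ (suc n) o x y with x <? o + 2 ^ n | y <? o + 2 ^ n
... | yes _ | yes _ = δ n o x y
... | no _  | no _  = δ n (o + 2 ^ n) x y
... | yes _ | no _  = n
... | no _  | yes _ = n

δ-low : ∀ n o {x y} → x < o + 2 ^ n → y < o + 2 ^ n → δ (suc n) o x y ≡ δ n o x y
δ-low n o {x} {y} x< y< with x <? o + 2 ^ n | y <? o + 2 ^ n
... | yes _ | yes _ = refl
... | yes _ | no y≮ = contradiction y< y≮
... | no x≮ | _     = contradiction x< x≮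

δ-high : ∀ n o {x y} → o + 2 ^ n ≤ x → o + 2 ^ n ≤ y → δ (suc n) o x y ≡ δ n (o + 2 ^ n) x y
δ-high n o {x} {y} ≤x ≤y with x <? o + 2 ^ n | y <? o + 2 ^ n
... | no _   | no _   = refl
... | no _   | yes y< = contradiction ≤y (<⇒≱ y<)
... | yes x< | _      = contradiction ≤x (<⇒≱ x<)

δ-across : ∀ n o {x y} → x < o + 2 ^ n → o + 2 ^ n ≤ y → δ (suc n) o x y ≡ n
δ-across n o {x} {y} x< ≤y with x <? o + 2 ^ n | y <? o + 2 ^ n
... | yes _ | no _   = refl
... | yes _ | yes y< = contradiction ≤y (<⇒≱ y<)
... | no x≮ | _      = contradiction x< x≮

-- The binary tree of a sorted list

splitAtPivot : ∀ p {xs} → Sorted xs → ∃₂ λ l r →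
  xs ≡ l ++ r × Sorted l × Sorted r × All (_< p) l × All (p ≤_) r
splitAtPivot p []                      = [] , [] , refl , [] , [] , [] , []
splitAtPivot p {x ∷ xs} (x<xs ∷ s) with x <? p
... | no x≮p = [] , x ∷ xs , refl , [] , x<xs ∷ s , [] ,
               ≮⇒≥ x≮p ∷ All.map (λ x<y → ≤-trans (≮⇒≥ x≮p) (<⇒≤ x<y)) x<xs
... | yes x<p with l , r , refl , sl , sr , l<p , p≤r ← splitAtPivot p s =
  x ∷ l , r , refl , All.++⁻ˡ l x<xs ∷ sl , sr , x<p ∷ l<p , p≤r

Within : (n o x : ℕ) → Set
Within n o x = o ≤ x × x < o + 2 ^ n

module _ (Δ : ℕ → ℕ → ℕ) where
  open Levels Δ

  -- The recursion halves the window and thereby changes the arguments of `δ`, while one function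
  -- must measure all levels of the tree. Hence the separate `Δ`, which has to agree with `δ n o` on
  -- the current window only.
  buildTree : ∀ n o {xs} →
    (∀ {x y} → Within n o x → Within n o y → Δ x y ≡ δ n o x y) →
    Sorted xs → All (Within n o) xs → 0 < length xs → Tree n xs
  buildTree zero o {x ∷ []} Δ≡δ s w _ = leaf x
  buildTree zero o {x ∷ y ∷ xs} Δ≡δ ((x<y ∷ _) ∷ _) ((o≤x , _) ∷ (_ , y<) ∷ _) _ =
    contradiction (≤-<-trans o≤x x<y) (≤⇒≯ (≤-pred (≤-trans y< (≤-reflexive (+-comm o 1)))))
  buildTree (suc n) o Δ≡δ s w 0< with splitAtPivot (o + 2 ^ n) s
  ... | l , r , refl , sl , sr , l<p , p≤r = join l r sl sr
      (All.zip (All.map proj₁ (All.++⁻ˡ l w) , l<p))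
      (All.zip (p≤r , All.map (λ (_ , y<) → <-≤-trans y< (≤-reflexive o+2ⁿ⁺¹)) (All.++⁻ʳ l w))) 0<
    where
    o+2ⁿ⁺¹ : o + 2 ^ suc n ≡ o + 2 ^ n + 2 ^ n
    o+2ⁿ⁺¹ = trans (cong (λ z → o + (2 ^ n + z)) (+-identityʳ (2 ^ n))) (sym (+-assoc o _ _))
    upper : ∀ {x} → x < o + 2 ^ n → x < o + 2 ^ suc n
    upper x< = <-≤-trans x< (≤-trans (m≤m+n _ (2 ^ n)) (≤-reflexive (sym o+2ⁿ⁺¹)))
    fromLow : ∀ {x} → Within n o x → Within (suc n) o x
    fromLow (≤x , x<) = ≤x , upper x<
    fromHigh : ∀ {x} → Within n (o + 2 ^ n) x → Within (suc n) o x
    fromHigh (≤x , x<) = ≤-trans (m≤m+n o _) ≤x , <-≤-trans x< (≤-reflexive (sym o+2ⁿ⁺¹))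
    left : ∀ {l} → Sorted l → All (Within n o) l → 0 < length l → Tree n l
    left = buildTree n o λ x∈ y∈ →
      trans (Δ≡δ (fromLow x∈) (fromLow y∈)) (δ-low n o (proj₂ x∈) (proj₂ y∈))
    right : ∀ {r} → Sorted r → All (Within n (o + 2 ^ n)) r → 0 < length r → Tree n r
    right = buildTree n (o + 2 ^ n) λ x∈ y∈ →
      trans (Δ≡δ (fromHigh x∈) (fromHigh y∈)) (δ-high n o (proj₁ x∈) (proj₁ y∈))
    join : ∀ l r → Sorted l → Sorted r → All (Within n o) l → All (Within n (o + 2 ^ n)) r →
               0 < length (l ++ r) → Tree (suc n) (l ++ r)
    -- If one half is empty, no branching happens at level `n`, and the tree of the other half is
    -- kept with a weaker bound.
    join [] r sl sr wl wr 0< = Tree-mono (n≤1+n n) (right sr wr 0<)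
    join l@(_ ∷ _) [] sl sr wl wr 0< =
      subst (Tree (suc n)) (sym (++-identityʳ l)) (Tree-mono (n≤1+n n) (left sl wl z<s))
    join l@(_ ∷ _) r@(_ ∷ _) sl sr wl wr 0< =
      node ≤-refl (left sl wl z<s) (right sr wr z<s)
        (All.map (λ x∈ → All.map (λ y∈ →
          trans (Δ≡δ (fromLow x∈) (fromHigh y∈)) (δ-across n o (proj₂ x∈) (proj₁ y∈))) wr) wl)

Rainbow-⊆ : ∀ {q} {χ : List ℕ → Fin q} {k xs ys} → xs ⊆ ys → Rainbow χ k xs → Rainbow χ k ys
Rainbow-⊆ xs⊆ys ρ = record
  { edge = edge ; edge-⊆ = λ i → ⊆-trans (edge-⊆ i) xs⊆ys
  ; length-edge = length-edge ; distinct = distinct }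
  where open Rainbow ρ

-- The stepped-up colouring

module StepUp {q} (χ : List ℕ → Fin q) (N : ℕ) where

  open Levels (δ N 0)
  open Shapes (δ N 0)

  -- Both reading orders are recorded because a path of right turns yields its levels in decreasing
  -- order, whereas `FiveColoured` speaks of increasing lists.
  stepUp : List ℕ → Fin (5 * (q * q))
  stepUp e = combine (shapeOf ds) (combine (χ ds) (χ (reverse ds)))
    where ds = levels e

  stepUp-shape : ∀ e f → stepUp e ≡ stepUp f → shapeOf (levels e) ≡ shapeOf (levels f)
  stepUp-shape e f = combine-injectiveˡ _ _ _ _

  stepUp-levels : ∀ e f → stepUp e ≡ stepUp f → χ (levels e) ≡ χ (levels f)
  stepUp-levels e f =
    combine-injectiveˡ _ (χ (reverse (levels e))) _ _ ∘
    combine-injectiveʳ (shapeOf (levels e)) _ (shapeOf (levels f)) _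

  stepUp-reverse : ∀ e f → stepUp e ≡ stepUp f →
                   χ (reverse (levels e)) ≡ χ (reverse (levels f))
  stepUp-reverse e f =
    combine-injectiveʳ (χ (levels e)) _ (χ (levels f)) _ ∘
    combine-injectiveʳ (shapeOf (levels e)) _ (shapeOf (levels f)) _

  -- The levels of the chain form a sorted set of size `s` below `N`, on which χ shows five colours,
  -- and `realise` turns each of those k-sets of levels into k + 1 vertices. The hypothesis
  -- `recover` reads the old colour off the component of the new one that fits the direction ρ.
  chain⇒rainbow : ∀ {ρ k s xs} → FiveColoured k s N q χ → (∀ es → length (ρ es) ≡ length es) →
    (∀ e f {es fs} → levels e ≡ ρ es → levels f ≡ ρ fs → stepUp e ≡ stepUp f → χ es ≡ χ fs) →
    Chain ρ s N xs → Rainbow stepUp (suc k) xs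
  chain⇒rainbow {ρ} {k} five length-ρ recover c = record
    { edge        = λ i → let y , ys , _ = lift i in y ∷ ys
    ; edge-⊆      = λ i → let _ , _ , ys⊆ , _ = lift i in ys⊆
    ; length-edge = λ i → let y , ys , _ , eq = lift i in
        trans (length-levels y ys) (cong suc
          (trans (cong length eq) (trans (length-ρ _) (length-edge i))))
    ; distinct    = λ {i} {j} eq → let _ , _ , _ , eqᵢ = lift i ; _ , _ , _ , eqⱼ = lift j in
        distinct (recover _ _ eqᵢ eqⱼ eq)
    }
    where
    open Chain c
    open Rainbow (five sorted below (≤-reflexive (sym length-ds)))
    lift : ∀ i → ∃₂ λ y ys → y ∷ ys ⊆ _ × levels (y ∷ ys) ≡ ρ (edge i)
    lift i = realise (edge-⊆ i)

  -- All five quadruples are padded on the right with the same `ws`. This raises the uniformity but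
  -- keeps the first three levels, so the order type still separates the edges.
  perfect⇒rainbow : ∀ {b ys us ws} → ys ⊆ us → Perfect 3 b ys →
                    Rainbow stepUp (4 + length ws) (us ++ ws)
  perfect⇒rainbow {ws = ws} ys⊆us p = record
    { edge        = λ i → proj₁ (all i) ++ ws
    ; edge-⊆      = λ i → let _ , es⊆ , _ = all i in ++⁺ (⊆-trans es⊆ ys⊆us) ⊆-refl
    ; length-edge = λ i → let es , _ , len , _ = all i in
                          trans (length-++ es) (cong (_+ length ws) len)
    ; distinct    = λ {i} {j} eq →
        let es , _ , _ , shapeᵢ = all i ; fs , _ , _ , shapeⱼ = all j in
        trans (sym (shapeᵢ ws)) (trans (stepUp-shape (es ++ ws) (fs ++ ws) eq) (shapeⱼ ws))
    }
    where all = perfect⇒allShapes p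

  stepUp-fiveColoured : ∀ {j s} → FiveColoured (3 + j) s N q χ →
    FiveColoured (4 + j) (suc ((s + s) ^ 2 + j)) (2 ^ N) (5 * (q * q)) stepUp
  stepUp-fiveColoured {j} {s} five {xs} sorted below long =
    subst (Rainbow stepUp _) (take++drop≡id a xs) rainbow
    where
    -- The last `j` vertices are set aside as padding; more than (2s)² remain in front of them.
    a = length xs ∸ j
    us = take a xs
    ws = drop a xs
    j≤ : j ≤ length xs
    j≤ = ≤-trans (m≤n+m j _) (≤-trans (n≤1+n _) long)
    length-us : length us ≡ a
    length-us = trans (length-take a xs) (m≤n⇒m⊓n≡m (m∸n≤m _ j))
    length-ws : length ws ≡ j
    length-ws = trans (length-drop a xs) (m∸[m∸n]≡n j≤)
    us-long : (s + s) ^ 2 < length us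
    us-long = ≤-trans (m+n≤o⇒m≤o∸n (suc ((s + s) ^ 2)) long) (≤-reflexive (sym length-us))
    tree : Tree N us
    tree = buildTree (δ N 0) N 0 (λ _ _ → refl) (AllPairs.take⁺ a sorted)
      (All.map (z≤n ,_) (All.take⁺ a below)) (≤-<-trans z≤n us-long)
    rainbow : Rainbow stepUp (4 + j) (us ++ ws)
    -- Exponent 2 gives perfect trees of height 3, whose eight leaves carry all five order types.
    rainbow with chain-or-perfect 2 s s tree us-long
    ... | inj₁ c = Rainbow-⊆ (++⁺ʳ ws ⊆-refl)
      (chain⇒rainbow five (λ _ → refl)
        (λ { e f refl refl → stepUp-levels e f }) c)
    ... | inj₂ (inj₁ c) = Rainbow-⊆ (++⁺ʳ ws ⊆-refl)
      (chain⇒rainbow five length-reverse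
        (λ e f {es} {fs} eqₑ eqf eq → trans (sym (χ-reverse e eqₑ))
          (trans (stepUp-reverse e f eq) (χ-reverse f eqf))) c)
      where
      χ-reverse : ∀ e {es} → levels e ≡ reverse es → χ (reverse (levels e)) ≡ χ es
      χ-reverse e eq = cong χ (trans (cong reverse eq) (reverse-involutive _))
    ... | inj₂ (inj₂ (_ , ys⊆ , p)) =
      subst (λ k → Rainbow stepUp (4 + k) (us ++ ws)) length-ws (perfect⇒rainbow ys⊆ p)

-- The random colouring of pairs

*-interchange : ∀ a b c d → a * b * (c * d) ≡ a * c * (b * d)
*-interchange = solve-∀

^-distribʳ-* : ∀ n a b → (a * b) ^ n ≡ a ^ n * b ^ n
^-distribʳ-* zero    a b = refl
^-distribʳ-* (suc n) a b = trans (cong (a * b *_) (^-distribʳ-* n a b))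
                                 (*-interchange a b (a ^ n) (b ^ n))

-- Expectations over a finite uniform space are kept as integer sums, with `card` as the size of the
-- space, to avoid division. `Σ-<` is the first-moment principle that extracts an outcome.
record Summation (A : Set) : Set where
  field
    Σ      : (A → ℕ) → ℕ
    Σ-cong : ∀ {f g} → (∀ a → f a ≡ g a) → Σ f ≡ Σ g
    Σ-*    : ∀ c f → Σ (λ a → c * f a) ≡ c * Σ f
    Σ-+    : ∀ f g → Σ (λ a → f a + g a) ≡ Σ f + Σ g
    Σ-<    : ∀ {f g} → Σ f < Σ g → ∃ λ a → f a < g a

  card : ℕ
  card = Σ (λ _ → 1)

  Σ-*ʳ : ∀ f c → Σ (λ a → f a * c) ≡ Σ f * c
  Σ-*ʳ f c = trans (Σ-cong λ a → *-comm (f a) c) (trans (Σ-* c f) (*-comm c (Σ f)))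

  Σ-const : ∀ c → Σ (λ _ → c) ≡ card * c
  Σ-const c = trans (Σ-cong λ _ → sym (*-identityˡ c)) (Σ-*ʳ (λ _ → 1) c)

open Summation

<-+-split : ∀ {a b} c d → a + b < c + d → a < c ⊎ b < d
<-+-split {a} {b} c d lt with a <? c
... | yes a<c = inj₁ a<c
... | no a≮c  = inj₂ (+-cancelˡ-< c b d (≤-<-trans (+-monoˡ-≤ b (≮⇒≥ a≮c)) lt))

Σ-Fin : ∀ n → Summation (Fin n)
Σ-Fin zero = record
  { Σ = λ _ → 0 ; Σ-cong = λ _ → refl ; Σ-* = λ c _ → sym (*-zeroʳ c)
  ; Σ-+ = λ _ _ → refl ; Σ-< = λ () }
Σ-Fin (suc n) = record
  { Σ      = λ f → f zero + Σ S (f ∘ suc)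
  ; Σ-cong = λ eq → cong₂ _+_ (eq zero) (Σ-cong S (eq ∘ suc))
  ; Σ-*    = λ c f → trans (cong (c * f zero +_) (Σ-* S c (f ∘ suc)))
                           (sym (*-distribˡ-+ c (f zero) _))
  ; Σ-+    = λ f g → trans (cong (f zero + g zero +_) (Σ-+ S (f ∘ suc) (g ∘ suc)))
                           (interchange (f zero) (g zero) _ _)
  ; Σ-<    = λ {f} {g} lt → exists {f} {g} (<-+-split (g zero) (Σ S (g ∘ suc)) lt)
  }
  where
  S = Σ-Fin n
  interchange : ∀ a b c d → a + b + (c + d) ≡ a + c + (b + d)
  interchange = solve-∀
  exists : ∀ {f g} → f zero < g zero ⊎ Σ S (f ∘ suc) < Σ S (g ∘ suc) → ∃ λ a → f a < g a
  exists (inj₁ lt) = zero , lt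
  exists (inj₂ lt) = let a , lt′ = Σ-< S lt in suc a , lt′

Σ-Vec : ∀ {A} → Summation A → ∀ n → Summation (Vec A n)
Σ-Vec S zero = record
  { Σ = λ f → f [] ; Σ-cong = λ eq → eq [] ; Σ-* = λ _ _ → refl
  ; Σ-+ = λ _ _ → refl ; Σ-< = λ lt → [] , lt }
Σ-Vec S (suc n) = record
  { Σ      = λ f → Σ S (λ a → Σ Sⁿ (f ∘ (a ∷_)))
  ; Σ-cong = λ eq → Σ-cong S λ a → Σ-cong Sⁿ λ v → eq (a ∷ v)
  ; Σ-*    = λ c f → trans (Σ-cong S λ a → Σ-* Sⁿ c (f ∘ (a ∷_))) (Σ-* S c _)
  ; Σ-+    = λ f g → trans (Σ-cong S λ a → Σ-+ Sⁿ (f ∘ (a ∷_)) (g ∘ (a ∷_))) (Σ-+ S _ _)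
  ; Σ-<    = λ lt → let a , lt′ = Σ-< S lt ; v , lt″ = Σ-< Sⁿ lt′ in a ∷ v , lt″
  }
  where Sⁿ = Σ-Vec S n

card-Vec : ∀ {A} (S : Summation A) n → card (Σ-Vec S n) ≡ card S ^ n
card-Vec S zero    = refl
card-Vec S (suc n) = trans (Σ-const S _) (cong (card S *_) (card-Vec S n))

card-Fin : ∀ n → card (Σ-Fin n) ≡ n
card-Fin zero    = refl
card-Fin (suc n) = cong suc (card-Fin n)

-- The common probability of the bad events is the fraction Y / (X * card S).
union-bound : ∀ {Ω C : Set} (S : Summation Ω) (bad : C → Ω → ℕ) {X Y} cs →
              (∀ c → Σ S (bad c) * X ≡ Y) → length cs * Y < card S * X →
              ∃ λ ω → ∀ {c} → c ∈ cs → bad c ω ≡ 0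
union-bound {Ω} {C} S bad {X} {Y} cs weight rare =
  -- The number of violated constraints is compared with the constant 1: an outcome with fewer than
  -- one violation has none.
  let ω , lt = Σ-< S (*-cancelʳ-< X _ _ (subst (_< card S * X) (sym (total cs)) rare)) in
  ω , λ c∈ → n≤0⇒n≡0 (≤-trans (member c∈) (≤-pred lt))
  where
  violations : List C → Ω → ℕ
  violations cs ω = sum (map (λ c → bad c ω) cs)
  total : ∀ cs → Σ S (violations cs) * X ≡ length cs * Y
  total []       = cong (_* X) (Σ-* S 0 (λ _ → 0))
  total (c ∷ cs) = trans (cong (_* X) (Σ-+ S (bad c) (violations cs)))
    (trans (*-distribʳ-+ X (Σ S (bad c)) _) (cong₂ _+_ (weight c) (total cs)))
  member : ∀ {c cs ω} → c ∈ cs → bad c ω ≤ violations cs ω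
  member {cs = c ∷ cs} (here refl) = m≤m+n _ _
  member {cs = c ∷ cs} (there c∈)  = ≤-trans (member c∈) (m≤n+m _ _)

productOn : ∀ {A : Set} {n} → Subset n → (A → ℕ) → Vec A n → ℕ
productOn []            g []      = 1
productOn (inside ∷ p)  g (a ∷ v) = g a * productOn p g v
productOn (outside ∷ p) g (a ∷ v) = productOn p g v

productOn≡0 : ∀ {A : Set} {n} (p : Subset n) (g : A → ℕ) v → productOn p g v ≡ 0 →
              ∃ λ j → j Subset.∈ p × g (Vec.lookup v j) ≡ 0
productOn≡0 []            g []      ()
productOn≡0 (inside ∷ p)  g (a ∷ v) eq with m*n≡0⇒m≡0∨n≡0 (g a) eq
... | inj₁ ga≡0 = zero , here , ga≡0
... | inj₂ rest = let j , j∈ , eq′ = productOn≡0 p g v rest in suc j , there j∈ , eq′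
productOn≡0 (outside ∷ p) g (a ∷ v) eq =
  let j , j∈ , eq′ = productOn≡0 p g v eq in suc j , there j∈ , eq′

-- Independence of the coordinates, with card S ^ ∣ p ∣ moved to the left instead of a division.
Σ-productOn : ∀ {A} (S : Summation A) (g : A → ℕ) {n} (p : Subset n) →
  Σ (Σ-Vec S n) (productOn p g) * card S ^ ∣ p ∣ ≡ Σ S g ^ ∣ p ∣ * card S ^ n
Σ-productOn S g [] = refl
Σ-productOn S g {suc n} (inside ∷ p) = begin
  Σ S (λ a → Σ Sⁿ (λ v → g a * productOn p g v)) * (K * K ^ ∣ p ∣)
    ≡⟨ cong (_* (K * K ^ ∣ p ∣)) (trans (Σ-cong S λ a → Σ-* Sⁿ (g a) _) (Σ-*ʳ S g _)) ⟩
  Σ S g * W * (K * K ^ ∣ p ∣)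
    ≡⟨ *-interchange (Σ S g) W K (K ^ ∣ p ∣) ⟩
  Σ S g * K * (W * K ^ ∣ p ∣)
    ≡⟨ cong (Σ S g * K *_) (Σ-productOn S g p) ⟩
  Σ S g * K * (Σ S g ^ ∣ p ∣ * K ^ n)
    ≡⟨ *-interchange (Σ S g) K (Σ S g ^ ∣ p ∣) (K ^ n) ⟩
  Σ S g * Σ S g ^ ∣ p ∣ * (K * K ^ n) ∎
  where
  open ≡-Reasoning
  Sⁿ = Σ-Vec S n
  K = card S
  W = Σ Sⁿ (productOn p g)
Σ-productOn S g {suc n} (outside ∷ p) = begin
  Σ S (λ _ → W) * K ^ ∣ p ∣       ≡⟨ cong (_* K ^ ∣ p ∣) (Σ-const S W) ⟩
  K * W * K ^ ∣ p ∣               ≡⟨ *-assoc K W _ ⟩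
  K * (W * K ^ ∣ p ∣)             ≡⟨ cong (K *_) (Σ-productOn S g p) ⟩
  K * (Σ S g ^ ∣ p ∣ * K ^ n)     ≡⟨ swap K (Σ S g ^ ∣ p ∣) (K ^ n) ⟩
  Σ S g ^ ∣ p ∣ * (K * K ^ n)     ∎
  where
  open ≡-Reasoning
  K = card S
  W = Σ (Σ-Vec S n) (productOn p g)
  swap : ∀ a b c → a * (b * c) ≡ b * (a * c)
  swap = solve-∀

subsets : ∀ s n → List (Edge s n)
subsets zero    zero    = [ [] , refl ]
subsets (suc s) zero    = []
subsets zero    (suc n) = map (Product.map (outside ∷_) id) (subsets zero n)
subsets (suc s) (suc n) = map (Product.map (outside ∷_) id) (subsets (suc s) n) ++
                          map (Product.map (inside ∷_) (cong suc)) (subsets s n)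

∈-subsets : ∀ {s n} (p : Subset n) (eq : ∣ p ∣ ≡ s) → (p , eq) ∈ subsets s n
∈-subsets           []            refl = here refl
∈-subsets           (inside ∷ p)  refl =
  ∈-++⁺ʳ (map (Product.map (outside ∷_) id) (subsets (suc ∣ p ∣) _)) (∈-map⁺ _ (∈-subsets p refl))
∈-subsets {zero}    (outside ∷ p) eq   = ∈-map⁺ _ (∈-subsets p eq)
∈-subsets {suc s}   (outside ∷ p) eq   = ∈-++⁺ˡ (∈-map⁺ _ (∈-subsets p eq))

-- The recursion is Pascal's rule. This crude bound on the binomial coefficient suffices, since a
-- fixed bad event has probability exponentially small in s².
length-subsets : ∀ s n → length (subsets s n) ≤ n ^ s
length-subsets zero    zero    = ≤-refl
length-subsets (suc s) zero    = z≤n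
length-subsets zero    (suc n) =
  ≤-trans (≤-reflexive (length-map _ (subsets zero n))) (length-subsets zero n)
length-subsets (suc s) (suc n) = begin
  length (subsets (suc s) (suc n))
    ≡⟨ length-++ (map _ (subsets (suc s) n)) ⟩
  length (map _ (subsets (suc s) n)) + length (map _ (subsets s n))
    ≡⟨ cong₂ _+_ (length-map _ (subsets (suc s) n)) (length-map _ (subsets s n)) ⟩
  length (subsets (suc s) n) + length (subsets s n)
    ≤⟨ +-mono-≤ (length-subsets (suc s) n) (length-subsets s n) ⟩
  n * n ^ s + n ^ s       ≡⟨ +-comm (n * n ^ s) _ ⟩
  suc n * n ^ s           ≤⟨ *-monoʳ-≤ (suc n) (^-monoˡ-≤ s (n≤1+n n)) ⟩
  suc n * suc n ^ s       ∎
  where open ≤-Reasoning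

length-cartesianProduct : ∀ {A B : Set} (xs : List A) (ys : List B) →
                          length (cartesianProduct xs ys) ≡ length xs * length ys
length-cartesianProduct []       ys = refl
length-cartesianProduct (x ∷ xs) ys = trans (length-++ (map (x ,_) ys))
  (cong₂ _+_ (length-map _ ys) (length-cartesianProduct xs ys))

avoid : ∀ {q} → Fin q → Fin q → ℕ
avoid i j with i Fin.≟ j
... | yes _ = 0
... | no _  = 1

avoid≡0 : ∀ {q} {i j : Fin q} → avoid i j ≡ 0 → i ≡ j
avoid≡0 {i = i} {j} eq with i Fin.≟ j
avoid≡0 eq | yes i≡j = i≡j

Σ-avoid : (i : Fin 5) → Σ (Σ-Fin 5) (avoid i) ≡ 4
Σ-avoid zero                         = refl
Σ-avoid (suc zero)                   = refl
Σ-avoid (suc (suc zero))             = refl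
Σ-avoid (suc (suc (suc zero)))       = refl
Σ-avoid (suc (suc (suc (suc zero)))) = refl

-- Random matrices with every colour on every s by s rectangle

module Matrices (s N : ℕ) where

  -- Colouring all ordered pairs keeps the sample space a plain product. An edge with increasing
  -- vertices reads the row of its first vertex and the column of its second.
  Matrix : Set
  Matrix = Vec (Vec (Fin 5) N) N

  rows : Summation (Vec (Fin 5) N)
  rows = Σ-Vec (Σ-Fin 5) N

  allMatrices : Summation Matrix
  allMatrices = Σ-Vec rows N

  -- The indicator that colour `i` is missing from the rectangle p × p′: a product over the columns
  -- in `p′` inside a product over the rows in `p`.
  bad : Edge s N × Edge s N × Fin 5 → Matrix → ℕ
  bad ((p , _) , (p′ , _) , i) = productOn p (productOn p′ (avoid i))

  -- A fixed rectangle misses a fixed colour with probability (4/5)^(s²). Independence enters twice,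
  -- among the s entries of a row and among the s rows; the common factor `R ^ s` is then cancelled.
  Σ-bad : ∀ c → Σ allMatrices (bad c) * (5 ^ s) ^ s ≡ (4 ^ s) ^ s * card allMatrices
  Σ-bad ((p , refl) , (p′ , eq) , i) = *-cancelʳ-≡ _ _ (R ^ s) {{m^n≢0 R s {{R≢0}}}} (begin
    w * (5 ^ s) ^ s * R ^ s           ≡⟨ swapʳ w _ _ ⟩
    w * R ^ s * (5 ^ s) ^ s
      ≡⟨ cong (_* (5 ^ s) ^ s) (Σ-productOn rows (productOn p′ (avoid i)) p) ⟩
    r ^ s * R ^ N * (5 ^ s) ^ s       ≡⟨ swapʳ (r ^ s) _ _ ⟩
    r ^ s * (5 ^ s) ^ s * R ^ N       ≡⟨ cong (_* R ^ N) (sym (^-distribʳ-* s r (5 ^ s))) ⟩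
    (r * 5 ^ s) ^ s * R ^ N           ≡⟨ cong (λ z → z ^ s * R ^ N) row ⟩
    (4 ^ s * R) ^ s * R ^ N           ≡⟨ cong (_* R ^ N) (^-distribʳ-* s (4 ^ s) R) ⟩
    (4 ^ s) ^ s * R ^ s * R ^ N       ≡⟨ swapʳ ((4 ^ s) ^ s) _ _ ⟩
    (4 ^ s) ^ s * R ^ N * R ^ s
      ≡⟨ cong (λ z → (4 ^ s) ^ s * z * R ^ s) (sym (card-Vec rows N)) ⟩
    (4 ^ s) ^ s * card allMatrices * R ^ s ∎)
    where
    open ≡-Reasoning
    R = card rows
    r = Σ rows (productOn p′ (avoid i))
    w = Σ allMatrices (bad ((p , refl) , (p′ , eq) , i))
    R≡5^N : R ≡ 5 ^ N
    R≡5^N = card-Vec (Σ-Fin 5) N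
    R≢0 : NonZero R
    R≢0 = subst NonZero (sym R≡5^N) (m^n≢0 5 N)
    swapʳ : ∀ a b c → a * b * c ≡ a * c * b
    swapʳ = solve-∀
    row : r * 5 ^ s ≡ 4 ^ s * R
    row = begin
      r * 5 ^ s           ≡⟨ cong (λ z → r * 5 ^ z) (sym eq) ⟩
      r * 5 ^ ∣ p′ ∣      ≡⟨ Σ-productOn (Σ-Fin 5) (avoid i) p′ ⟩
      Σ (Σ-Fin 5) (avoid i) ^ ∣ p′ ∣ * 5 ^ N ≡⟨ cong₂ (λ a b → a ^ b * 5 ^ N) (Σ-avoid i) eq ⟩
      4 ^ s * 5 ^ N       ≡⟨ cong (4 ^ s *_) (sym R≡5^N) ⟩
      4 ^ s * R           ∎

  Colourful : Matrix → Set
  Colourful M = ∀ (p p′ : Subset N) → ∣ p ∣ ≡ s → ∣ p′ ∣ ≡ s → ∀ i →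
    ∃₂ λ x y → x Subset.∈ p × y Subset.∈ p′ × Vec.lookup (Vec.lookup M x) y ≡ i

  constraints : List (Edge s N × Edge s N × Fin 5)
  constraints = cartesianProduct (subsets s N) (cartesianProduct (subsets s N) (allFin 5))

  length-constraints : length constraints ≤ N ^ s * (N ^ s * 5)
  length-constraints = begin
    length constraints
      ≡⟨ length-cartesianProduct (subsets s N) _ ⟩
    length (subsets s N) * length (cartesianProduct (subsets s N) (allFin 5))
      ≡⟨ cong (length (subsets s N) *_) (length-cartesianProduct (subsets s N) (allFin 5)) ⟩
    length (subsets s N) * (length (subsets s N) * 5)
      ≤⟨ *-mono-≤ (length-subsets s N) (*-monoˡ-≤ 5 (length-subsets s N)) ⟩
    N ^ s * (N ^ s * 5) ∎
    where open ≤-Reasoning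

  colourful : N ^ s * (N ^ s * 5) * (4 ^ s) ^ s < (5 ^ s) ^ s → ∃ Colourful
  colourful h = M , λ p p′ eq eq′ i →
    let x , x∈ , row≡0 = productOn≡0 p _ M (good {(p , eq) , (p′ , eq′) , i}
          (∈-cartesianProduct⁺ (∈-subsets p eq)
            (∈-cartesianProduct⁺ (∈-subsets p′ eq′) (∈-allFin i))))
        y , y∈ , entry≡0 = productOn≡0 p′ _ (Vec.lookup M x) row≡0
    in x , y , x∈ , y∈ , sym (avoid≡0 entry≡0)
    where
    K = card allMatrices
    K>0 : NonZero K
    K>0 = subst NonZero (sym (trans (card-Vec rows N) (cong (_^ N) (card-Vec (Σ-Fin 5) N))))
            (m^n≢0 (5 ^ N) N {{m^n≢0 5 N}})
    few : length constraints * ((4 ^ s) ^ s * K) < K * (5 ^ s) ^ s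
    few = begin-strict
      length constraints * ((4 ^ s) ^ s * K)
        ≡⟨ sym (*-assoc (length constraints) _ K) ⟩
      length constraints * (4 ^ s) ^ s * K
        ≤⟨ *-monoˡ-≤ K (*-monoˡ-≤ ((4 ^ s) ^ s) length-constraints) ⟩
      N ^ s * (N ^ s * 5) * (4 ^ s) ^ s * K
        <⟨ *-monoˡ-< K {{K>0}} h ⟩
      (5 ^ s) ^ s * K
        ≡⟨ *-comm ((5 ^ s) ^ s) K ⟩
      K * (5 ^ s) ^ s ∎
      where open ≤-Reasoning
    found : ∃ λ M → ∀ {c} → c ∈ constraints → bad c M ≡ 0
    found = union-bound allMatrices bad constraints Σ-bad few
    M = proj₁ found
    good = proj₂ found

-- The factor 4 in s is the least e with 2 · 4ᵉ < 5ᵉ.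
pow-bound : ∀ m → let s = 4 * (m + suc m) in
  (2 ^ m) ^ s * ((2 ^ m) ^ s * 5) * (4 ^ s) ^ s < (5 ^ s) ^ s
pow-bound m = begin-strict
  (2 ^ m) ^ s * ((2 ^ m) ^ s * 5) * (4 ^ s) ^ s
    ≡⟨ cong₂ (λ a b → a * (a * 5) * b) (^-*-assoc 2 m s) (square 4) ⟩
  2 ^ (m * s) * (2 ^ (m * s) * 5) * 256 ^ (u * s)
    ≤⟨ *-monoˡ-≤ (256 ^ (u * s)) (*-monoʳ-≤ (2 ^ (m * s)) (*-monoʳ-≤ (2 ^ (m * s)) 5≤2^s)) ⟩
  2 ^ (m * s) * (2 ^ (m * s) * 2 ^ s) * 256 ^ (u * s)
    ≡⟨ cong (_* 256 ^ (u * s)) exponents ⟩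
  2 ^ (u * s) * 256 ^ (u * s)
    ≡⟨ sym (^-distribʳ-* (u * s) 2 256) ⟩
  512 ^ (u * s)
    <⟨ ^-monoˡ-< (u * s) {{us≢0}} (<ᵇ⇒< 512 625 _) ⟩
  625 ^ (u * s)
    ≡⟨ sym (square 5) ⟩
  (5 ^ s) ^ s ∎
  where
  open ≤-Reasoning
  -- Here 2m comes from the two factors (2 ^ m) ^ s and the additional 1 from 5 ≤ 2 ^ s. Both sides
  -- thus become powers with exponent u s, and 512 < 625 decides.
  u = m + suc m
  s = 4 * u
  u≥1 : 1 ≤ u
  u≥1 = ≤-trans (s≤s z≤n) (m≤n+m (suc m) m)
  s≥4 : 4 ≤ s
  s≥4 = *-monoʳ-≤ 4 {1} u≥1
  5≤2^s : 5 ≤ 2 ^ s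
  5≤2^s = ≤-trans (≤ᵇ⇒≤ 5 16 _) (^-monoʳ-≤ 2 s≥4)
  us≢0 : NonZero (u * s)
  us≢0 = m*n≢0 u s {{>-nonZero u≥1}} {{>-nonZero (≤-trans (s≤s z≤n) s≥4)}}
  square : ∀ a → (a ^ s) ^ s ≡ (a ^ 4) ^ (u * s)
  square a = trans (^-*-assoc a s s)
    (trans (cong (a ^_) (*-assoc 4 u s)) (sym (^-*-assoc a 4 (u * s))))
  exponents : 2 ^ (m * s) * (2 ^ (m * s) * 2 ^ s) ≡ 2 ^ (u * s)
  exponents = trans (cong (2 ^ (m * s) *_) (sym (^-distribˡ-+-* 2 (m * s) s)))
    (trans (sym (^-distribˡ-+-* 2 (m * s) (m * s + s))) (cong (2 ^_) (sums m s)))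
    where
    sums : ∀ m s → m * s + (m * s + s) ≡ (m + suc m) * s
    sums = solve-∀

-- Subsets as sorted lists

elementsFrom : ∀ {n} → ℕ → Subset n → List ℕ
elementsFrom o []            = []
elementsFrom o (inside ∷ p)  = o ∷ elementsFrom (suc o) p
elementsFrom o (outside ∷ p) = elementsFrom (suc o) p

length-elementsFrom : ∀ {n} o (p : Subset n) → length (elementsFrom o p) ≡ ∣ p ∣
length-elementsFrom o []            = refl
length-elementsFrom o (inside ∷ p)  = cong suc (length-elementsFrom (suc o) p)
length-elementsFrom o (outside ∷ p) = length-elementsFrom (suc o) p

∈-elementsFrom : ∀ {n} o {p : Subset n} {x} → x Subset.∈ p → o + toℕ x ∈ elementsFrom o p
∈-elementsFrom o {inside ∷ p} here = here (+-identityʳ o)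
∈-elementsFrom o {b ∷ p} {suc x} (there x∈) = shift b
  where
  tail = subst (_∈ elementsFrom (suc o) p) (sym (+-suc o (toℕ x))) (∈-elementsFrom (suc o) x∈)
  shift : ∀ b → o + toℕ (suc x) ∈ elementsFrom o (b ∷ p)
  shift inside  = there tail
  shift outside = tail

fromSorted : ∀ n o {xs} → Sorted xs → All (o ≤_) xs → All (_< o + n) xs →
             ∃ λ (p : Subset n) → elementsFrom o p ≡ xs
fromSorted zero    o {[]}     _ _ _ = [] , refl
fromSorted zero    o {x ∷ xs} _ (o≤x ∷ _) (x<o ∷ _) =
  contradiction (<-≤-trans x<o (≤-reflexive (+-identityʳ o))) (≤⇒≯ o≤x)
fromSorted (suc n) o {[]}     _ _ _ =
  let p , eq = fromSorted n (suc o) [] [] [] in outside ∷ p , eq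
fromSorted (suc n) o {x ∷ xs} (x<xs ∷ s) (o≤x ∷ _) xs<
  with All.map (λ y< → <-≤-trans y< (≤-reflexive (+-suc o n))) xs< | o ≟ x
... | _ ∷ below | yes refl =
  let p , eq = fromSorted n (suc o) s x<xs below in inside ∷ p , cong (o ∷_) eq
... | below     | no o≢x   =
  let o<x = ≤∧≢⇒< o≤x o≢x
      p , eq = fromSorted n (suc o) (x<xs ∷ s) (o<x ∷ All.map (<-trans o<x) x<xs) below
  in outside ∷ p , eq

elementsFrom-bounds : ∀ {n} o (p : Subset n) → All (λ x → o ≤ x × x < o + n) (elementsFrom o p)
elementsFrom-bounds o []      = []
elementsFrom-bounds {suc n} o (b ∷ p) = cons b
  where
  tail = All.map (λ (o<x , x<) → <⇒≤ o<x , <-≤-trans x< (≤-reflexive (sym (+-suc o n))))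
           (elementsFrom-bounds (suc o) p)
  cons : ∀ b → All (λ x → o ≤ x × x < o + suc n) (elementsFrom o (b ∷ p))
  cons inside  = (≤-refl , m<m+n o z<s) ∷ tail
  cons outside = tail

elementsFrom-sorted : ∀ {n} o (p : Subset n) → Sorted (elementsFrom o p)
elementsFrom-sorted o []            = []
elementsFrom-sorted o (inside ∷ p)  =
  All.map proj₁ (elementsFrom-bounds (suc o) p) ∷ elementsFrom-sorted (suc o) p
elementsFrom-sorted o (outside ∷ p) = elementsFrom-sorted (suc o) p

fromSublist : ∀ {n} o (S : Subset n) {es} → es ⊆ elementsFrom o S →
              ∃ λ e → e Subset.⊆ S × elementsFrom o e ≡ es
fromSublist o []            []          = [] , id , refl
fromSublist o (inside ∷ S)  (_ ∷ʳ es⊆)  =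
  let e , e⊆ , eq = fromSublist (suc o) S es⊆ in
  outside ∷ e , (λ { (there x∈) → there (e⊆ x∈) }) , eq
fromSublist o (inside ∷ S)  (refl ∷ es⊆) =
  let e , e⊆ , eq = fromSublist (suc o) S es⊆ in
  inside ∷ e , (λ { here → here ; (there x∈) → there (e⊆ x∈) }) , cong (o ∷_) eq
fromSublist o (outside ∷ S) es⊆ =
  let e , e⊆ , eq = fromSublist (suc o) S es⊆ in
  outside ∷ e , (λ { (there x∈) → there (e⊆ x∈) }) , eq

entryAt : ∀ {A : Set} {n} → A → Vec A n → ℕ → A
entryAt d []      _       = d
entryAt d (a ∷ v) zero    = a
entryAt d (a ∷ v) (suc i) = entryAt d v i

entryAt-toℕ : ∀ {A : Set} {n} (d : A) (v : Vec A n) i → entryAt d v (toℕ i) ≡ Vec.lookup v i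
entryAt-toℕ d (a ∷ v) zero    = refl
entryAt-toℕ d (a ∷ v) (suc i) = entryAt-toℕ d v i

-- From matrices to triples

module PairColouring (s N : ℕ) (M : Matrices.Matrix s N)
  (M-colourful : Matrices.Colourful s N M) where

  entry : ℕ → ℕ → Fin 5
  entry x y = entryAt zero (entryAt (Vec.replicate N zero) M x) y

  χ : List ℕ → Fin 5
  χ (x ∷ y ∷ _) = entry x y
  χ _           = zero

  entries : ∀ {as bs} → Sorted as → Sorted bs → All (_< N) as → All (_< N) bs →
            length as ≡ s → length bs ≡ s → ∀ i → ∃₂ λ a b → a ∈ as × b ∈ bs × entry a b ≡ i
  entries sa sb a<N b<N la lb i
    with p  , refl ← fromSorted N 0 sa (All.map (λ _ → z≤n) a<N) a<N
       | p′ , refl ← fromSorted N 0 sb (All.map (λ _ → z≤n) b<N) b<N =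
    let x , y , x∈ , y∈ , eq = M-colourful p p′
          (trans (sym (length-elementsFrom 0 p)) la) (trans (sym (length-elementsFrom 0 p′)) lb) i
    in toℕ x , toℕ y , ∈-elementsFrom 0 x∈ , ∈-elementsFrom 0 y∈ ,
       trans (cong (λ v → entryAt zero v (toℕ y)) (entryAt-toℕ _ M x))
             (trans (entryAt-toℕ zero (Vec.lookup M x) y) eq)

  -- The first s vertices serve as rows, the next s as columns, and one further vertex completes the
  -- triple. Rows precede columns, so each triple found is a sublist.
  χ-fiveColoured : FiveColoured 3 (suc (s + s)) N 5 χ
  χ-fiveColoured {xs} sorted below long = subst (Rainbow χ 3) xs≡ (go cs c-long)
    where
    as = take s xs
    ys = drop s xs
    bs = take s ys
    cs = drop s ys
    xs≡ : as ++ bs ++ cs ≡ xs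
    xs≡ = trans (cong (as ++_) (take++drop≡id s ys)) (take++drop≡id s xs)
    y-long : suc s ≤ length ys
    y-long = ≤-trans (m+n≤o⇒m≤o∸n (suc s) long) (≤-reflexive (sym (length-drop s xs)))
    c-long : 1 ≤ length cs
    c-long = ≤-trans (m+n≤o⇒m≤o∸n 1 y-long) (≤-reflexive (sym (length-drop s ys)))
    pick : ∀ i → ∃₂ λ a b → a ∈ as × b ∈ bs × entry a b ≡ i
    pick = entries (AllPairs.take⁺ s sorted) (AllPairs.take⁺ s (AllPairs.drop⁺ s sorted))
      (All.take⁺ s below) (All.take⁺ s (All.drop⁺ s below))
      (trans (length-take s xs) (m≤n⇒m⊓n≡m (≤-trans (m≤n+m s (suc s)) long)))
      (trans (length-take s ys) (m≤n⇒m⊓n≡m (≤-trans (n≤1+n s) y-long)))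
    go : ∀ cs → 1 ≤ length cs → Rainbow χ 3 (as ++ bs ++ cs)
    go (c ∷ cs) _ = record
      { edge        = λ i → let a , b , _ = pick i in a ∷ b ∷ c ∷ []
      ; edge-⊆      = λ i → let _ , _ , a∈ , b∈ , _ = pick i in
                            ++⁺ (from∈ a∈) (++⁺ (from∈ b∈) (refl ∷ minimum cs))
      ; length-edge = λ _ → refl
      ; distinct    = λ {i} {j} eq →
                      let _ , _ , _ , _ , eqᵢ = pick i ; _ , _ , _ , _ , eqⱼ = pick j in
                      trans (sym eqᵢ) (trans eq eqⱼ)
      }

fiveColoured-triples : ∀ m → let s = 4 * (m + suc m) in
                       ∃ (FiveColoured 3 (suc (s + s)) (2 ^ m) 5)
fiveColoured-triples m =
  let M , M-colourful = Matrices.colourful s N (pow-bound m) in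
  PairColouring.χ s N M M-colourful , PairColouring.χ-fiveColoured s N M M-colourful
  where
  s = 4 * (m + suc m)
  N = 2 ^ m

-- From five-coloured sets to Ramsey numbers

rank : ∀ {n} {p : Subset n} {x} → x Subset.∈ p → Fin ∣ p ∣
rank {p = inside ∷ p}  here       = zero
rank {p = inside ∷ p}  (there x∈) = suc (rank x∈)
rank {p = outside ∷ p} (there x∈) = rank x∈

rank-injective : ∀ {n} {p : Subset n} {x y} (x∈ : x Subset.∈ p) (y∈ : y Subset.∈ p) →
                 rank x∈ ≡ rank y∈ → x ≡ y
rank-injective {p = inside ∷ p}  here       here       _  = refl
rank-injective {p = inside ∷ p}  (there x∈) (there y∈) eq =
  cong suc (rank-injective x∈ y∈ (suc-injective eq))
rank-injective {p = outside ∷ p} (there x∈) (there y∈) eq = cong suc (rank-injective x∈ y∈ eq)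

-- The colouring is restricted to the first `r` vertices. The colours of the rainbow edges lie in
-- `D`, and their ranks there inject `Fin 5` into `Fin ∣ D ∣`. Treating every r ≤ N at once replaces
-- a proof that arrowing is monotone in the number of vertices.
fiveColoured⇒¬Arrows : ∀ {k s N q χ} → FiveColoured k s N q χ →
                       ∀ {t r} → s ≤ t → r ≤ N → ¬ Arrows k t q 5 r
fiveColoured⇒¬Arrows {χ = χ} five s≤t r≤N arrows
  with S , refl , D , isColours , ∣D∣<5 ← arrows (λ e → χ (elementsFrom 0 (proj₁ e))) =
  <⇒≱ ∣D∣<5 (injective⇒≤ {f = λ i → rank (inD i)} λ {i} {j} eq →
    distinct (rank-injective (inD i) (inD j) eq))
  where
  open Rainbow (five (elementsFrom-sorted 0 S)
    (All.map (λ (_ , x<r) → <-≤-trans x<r r≤N) (elementsFrom-bounds 0 S))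
    (≤-trans s≤t (≤-reflexive (sym (length-elementsFrom 0 S)))))
  inD : ∀ i → χ (edge i) Subset.∈ D
  inD i = let e , e⊆S , eq = fromSublist 0 S (edge-⊆ i) in
    Equivalence.from (isColours (χ (edge i)))
      ((e , trans (sym (length-elementsFrom 0 e)) (trans (cong length eq) (length-edge i))) ,
       e⊆S , cong χ eq)

-- The iteration and its growth

size : (j m : ℕ) → ℕ
size zero    m = let s = 4 * (m + suc m) in suc (s + s)
size (suc j) m = suc ((size j m + size j m) ^ 2 + j)

-- This is the tower T_{j+2}(m) in the natural numbers.
vertices : (j m : ℕ) → ℕ
vertices zero    m = 2 ^ m
vertices (suc j) m = 2 ^ vertices j m

colours : ℕ → ℕ
colours zero    = 5
colours (suc j) = 5 * (colours j * colours j)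

5≤colours : ∀ j → 5 ≤ colours j
5≤colours zero    = ≤-refl
5≤colours (suc j) = *-monoʳ-≤ 5 {1} (*-mono-≤ {1} {_} {1} 1≤q 1≤q)
  where 1≤q = ≤-trans (s≤s z≤n) (5≤colours j)

fiveColoured : ∀ j m → ∃ (FiveColoured (3 + j) (size j m) (vertices j m) (colours j))
fiveColoured zero    m = fiveColoured-triples m
fiveColoured (suc j) m =
  let χ , five = fiveColoured j m in
  StepUp.stepUp χ (vertices j m) , StepUp.stepUp-fiveColoured χ (vertices j m) five

-- Squaring the size doubles the exponent, and one further factor m absorbs the constants.
degree : ℕ → ℕ
degree zero    = 2
degree (suc j) = suc (degree j * 2)

-- The base case needs m ≥ 17, for 9 + 16m ≤ 17m ≤ m². The step needs m ≥ 5 + j, where 4 comes from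
-- squaring a doubled size and 1 + j from the padding.
size≤pow : ∀ j m → 17 + j ≤ m → size j m ≤ m ^ degree j
size≤pow zero m 17≤m = begin
  suc (4 * (m + suc m) + 4 * (m + suc m)) ≡⟨ expand m ⟩
  9 + 16 * m       ≤⟨ +-monoˡ-≤ (16 * m) (≤-trans (≤ᵇ⇒≤ 9 17 _) 17≤m) ⟩
  17 * m           ≤⟨ *-monoˡ-≤ m 17≤m ⟩
  m * m            ≡⟨ cong (m *_) (sym (*-identityʳ m)) ⟩
  m ^ 2            ∎
  where
  open ≤-Reasoning
  expand : ∀ m → suc (4 * (m + suc m) + 4 * (m + suc m)) ≡ 9 + 16 * m
  expand = solve-∀
size≤pow (suc j) m 18+j≤m = begin
  suc ((z + z) ^ 2 + j)     ≡⟨ sym (+-suc ((z + z) ^ 2) j) ⟩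
  (z + z) ^ 2 + suc j       ≤⟨ +-mono-≤ (^-monoˡ-≤ 2 (+-mono-≤ z≤y z≤y)) 1+j≤ ⟩
  (y + y) ^ 2 + suc j * y ^ 2 ≡⟨ collect y j ⟩
  (5 + j) * y ^ 2           ≤⟨ *-monoˡ-≤ (y ^ 2) (≤-trans (+-monoˡ-≤ j (≤ᵇ⇒≤ 5 17 _)) 17+j≤m) ⟩
  m * y ^ 2                 ≡⟨ cong (m *_) (^-*-assoc m (degree j) 2) ⟩
  m ^ degree (suc j)        ∎
  where
  open ≤-Reasoning
  17+j≤m = ≤-trans (≤-trans (n≤1+n (17 + j)) (≤-reflexive (sym (+-suc 17 j)))) 18+j≤m
  z = size j m
  y = m ^ degree j
  z≤y : z ≤ y
  z≤y = size≤pow j m 17+j≤m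
  1+j≤ : suc j ≤ suc j * y ^ 2
  1+j≤ = m≤m*n (suc j) (y ^ 2) {{m^n≢0 y 2 {{y≢0}}}}
    where y≢0 = m^n≢0 m (degree j) {{>-nonZero (≤-trans (s≤s z≤n) 17+j≤m)}}
  collect : ∀ y j → (y + y) * ((y + y) * 1) + suc j * (y * (y * 1)) ≡ (5 + j) * (y * (y * 1))
  collect = solve-∀

floorRoot : ∀ e .{{_ : NonZero e}} t → ∃ λ m → m ^ e ≤ t × t < suc m ^ e
floorRoot (suc e) zero    = 0 , z≤n , m^n>0 1 (suc e)
floorRoot e (suc t) with floorRoot e t
... | m , m^e≤t , t< with suc t <? suc m ^ e
...   | yes st< = m , m≤n⇒m≤1+n m^e≤t , st<
...   | no st≮  = suc m , ≮⇒≥ st≮ , ≤-<-trans t< (^-monoˡ-< e (n<1+n (suc m)))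

-- Bounds on real powers

^ℝ-upper : ∀ {x m} → x ≤ℝ fromℕ m → 2 ^ℝ x ≤ℝ fromℕ (2 ^ m)
^ℝ-upper {m = m} x≤m (r , r<x , y , p<y , y≤2^r) =
  ℚ.<-≤-trans p<y (≤^-bounded m (ℚ.<⇒≤ (x≤m r<x)) y≤2^r)

tower-upper : ∀ j {x m} → x ≤ℝ fromℕ m → T (2 + j) x ≤ℝ fromℕ (vertices j m)
tower-upper zero    {x} {m} x≤m = ^ℝ-upper {x} {m} x≤m
tower-upper (suc j) {x} {m} x≤m =
  ^ℝ-upper {T (2 + j) x} {vertices j m} (tower-upper j {x} {m} x≤m)

reciprocal : (E : ℕ) .{{_ : NonZero E}} → ℝ
reciprocal E = fromℚ (ℤ.+ 1 ℚ./ E)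

reciprocal>0 : ∀ E .{{_ : NonZero E}} → 0ℝ <ℝ reciprocal E
reciprocal>0 E = ℚ.0ℚ , ℚ.positive⁻¹ (ℤ.+ 1 ℚ./ E) {{ℚ.normalize-pos 1 E}} , ℚ.<-irrefl refl

-- Let the exponent r < 1/E have numerator n and denominator D, so n E < D. If m < y, then m^D < y^D
-- ≤ t^n. But t^n ≤ m^(E n) ≤ m^D for n ≥ 0, and t^n ≤ 1 ≤ m^D for n < 0.
root-upper : ∀ E .{{_ : NonZero E}} {t m} .{{_ : NonZero t}} .{{_ : NonZero m}} →
             t ≤ m ^ E → t ^ℝ reciprocal E ≤ℝ fromℕ m
root-upper E@(suc e) {t} {m} t≤m^E {p} (r@(ℚ.mkℚ n d _) , r<1/E , y , p<y , mk 0≤y y^d≤) =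
  ℚ.<-≤-trans p<y (ℚ.≮⇒≥ λ m<y → ℚ.<-irrefl refl
    (ℚ.<-≤-trans (^ℚ-mono-< d 0<m m<y)
      (ℚ.≤-trans y^d≤ (subst (t ^ℤ n ℚ.≤_) (sym (nat-^ m (suc d))) (bound n nE<d)))))
  where
  0<m : ℚ.0ℚ ℚ.< nat m
  0<m = ℚ.<-≤-trans (ℚ.positive⁻¹ ℚ.1ℚ) (nat-mono {1} {m} (>-nonZero⁻¹ m))
  nE<d : n ℤ.* ℤ.+ E ℤ.< ℤ.+ 1 ℤ.* ℤ.+ suc d
  nE<d = ℚᵘ.drop-*<* (ℚᵘ.<-respʳ-≃ (ℚ.toℚᵘ-fromℚᵘ (ℚᵘ.mkℚᵘ (ℤ.+ 1) e)) (ℚ.toℚᵘ-mono-< r<1/E))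
  bound : ∀ n → n ℤ.* ℤ.+ E ℤ.< ℤ.+ 1 ℤ.* ℤ.+ suc d → t ^ℤ n ℚ.≤ nat (m ^ suc d)
  bound (ℤ.+ n) nE<d = nat-mono {t ^ n} (begin
    t ^ n        ≤⟨ ^-monoˡ-≤ n t≤m^E ⟩
    (m ^ E) ^ n  ≡⟨ ^-*-assoc m E n ⟩
    m ^ (E * n)  ≤⟨ ^-monoʳ-≤ m (≤-trans (≤-reflexive (*-comm E n)) (<⇒≤ (ℤ.drop‿+<+
                      (subst₂ ℤ._<_ (sym (ℤ.pos-* n E)) (ℤ.*-identityˡ (ℤ.+ suc d)) nE<d)))) ⟩
    m ^ suc d    ∎)
    where open ≤-Reasoning
  bound ℤ.-[1+ n ] _ = ℚ.≤-trans (^ℤ-≤ t ℤ.-[1+ n ] 0 ℤ.-≤+) (nat-mono {1} (m^n>0 m (suc d)))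

corollary1p4 : ∀ (k : ℕ) → 4 ≤ k →
    ∃[ q ] ∃[ c ] 5 ≤ q × 0ℝ <ℝ c ×
    (∃[ t₀ ] ∀ (t : ℕ) .{{_ : NonZero t}} → t₀ ≤ t →
    ∀ (r : ℕ) → IsRamseyNumber k t q 5 r →
    T (k ∸ 1) (t ^ℝ c) ≤ℝ fromℕ r)
corollary1p4 (suc (suc (suc (suc i)))) (s≤s (s≤s (s≤s (s≤s z≤n)))) =
  -- With m the integer part of t^(1/e), the set size is at most m^e ≤ t. Rounding leaves only t <
  -- (m + 1)^e ≤ m^(2e), which is why the exponent c is 1/(2e). The threshold for t forces m ≥ 17 +
  -- j.
  colours j , reciprocal (2 * e) {{E≢0}} , 5≤colours j , reciprocal>0 (2 * e) {{E≢0}} ,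
  (17 + j) ^ e , bound
  where
  -- This is k - 3, the number of steps up from triples, so that T_{k-1} is T_{2+j}.
  j = suc i
  e = degree j
  E≢0 : NonZero (2 * e)
  E≢0 = m*n≢0 2 e
  bound : ∀ t .{{_ : NonZero t}} → (17 + j) ^ e ≤ t →
          ∀ r → IsRamseyNumber (3 + j) t (colours j) 5 r →
          T (2 + j) (t ^ℝ reciprocal (2 * e) {{E≢0}}) ≤ℝ fromℕ r
  bound t t₀≤t r (arrows , _) {p} p<T =
    ℚ.<-≤-trans (tower-upper j {x} {m} x≤m {p} p<T)
      (nat-mono {vertices j m} {r} (<⇒≤ N<r))
    where
    x = t ^ℝ reciprocal (2 * e) {{E≢0}}
    root = floorRoot e t
    m = proj₁ root
    17+j≤m : 17 + j ≤ m
    17+j≤m = ≮⇒≥ λ m<17+j → <⇒≱ (proj₂ (proj₂ root)) (≤-trans (^-monoˡ-≤ e m<17+j) t₀≤t)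
    m≢0 : NonZero m
    m≢0 = >-nonZero (≤-trans (s≤s z≤n) 17+j≤m)
    N<r : vertices j m < r
    N<r = ≰⇒> λ r≤N → fiveColoured⇒¬Arrows (proj₂ (fiveColoured j m))
      (≤-trans (size≤pow j m 17+j≤m) (proj₁ (proj₂ root))) r≤N arrows
    t≤m^E : t ≤ m ^ (2 * e)
    t≤m^E = begin
      t             ≤⟨ <⇒≤ (proj₂ (proj₂ root)) ⟩
      suc m ^ e     ≤⟨ ^-monoˡ-≤ e 1+m≤m² ⟩
      (m ^ 2) ^ e   ≡⟨ ^-*-assoc m 2 e ⟩
      m ^ (2 * e)   ∎
      where
      open ≤-Reasoning
      1+m≤m² : suc m ≤ m ^ 2
      1+m≤m² = begin
        1 + m       ≤⟨ +-monoˡ-≤ m (≤-trans (s≤s z≤n) 17+j≤m) ⟩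
        m + m       ≡⟨ cong (m +_) (sym (+-identityʳ m)) ⟩
        2 * m       ≤⟨ *-monoˡ-≤ m (≤-trans (s≤s (s≤s z≤n)) 17+j≤m) ⟩
        m * m       ≡⟨ cong (m *_) (sym (*-identityʳ m)) ⟩
        m ^ 2       ∎
    x≤m : x ≤ℝ fromℕ m
    x≤m = root-upper (2 * e) {{E≢0}} {t} {m} {{it}} {{m≢0}} t≤m^E
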